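{- There exists a configuration $(2,4)$ $GDD(15,2,6;15,16)$.
   Context: A $GDD(n,2,6;\lambda_1,\lambda_2)$ is a finite collection (repetitions allowed) of $6$-element subsets, called blocks, of a $2n$-element set $X$ partitioned into two groups of size $n$, such that every point lies in the same number $r$ of blocks, any two distinct points of the same group lie together in exactly $\lambda_1$ blocks, and any two points from different groups lie together in exactly $\lambda_2$ blocks. It has configuration $(2,4)$ if every block has exactly $2$ points in one of the two groups and $4$ points in the other (which group contains the $2$ points may depend on the block). -}

module Defs where

open import Data.Fin.Base using (Fin; zero; suc)
open import Data.Fin.Properties using (_≟_)
open import Data.Fin.Subset using (Subset; ∣_∣; _∩_)
open import Data.Fin.Subset.Properties using (_∈?_)
open import Data.List.Base using (List; length; filter)
open import Data.List.Relation.Unary.All using (All)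
open import Data.Nat.Base using (ℕ; _*_)
open import Data.Product.Base using (_×_)
open import Data.Sum.Base using (_⊎_)
open import Data.Vec.Base using (tabulate)
open import Relation.Binary.PropositionalEquality using (_≡_; _≢_)
open import Relation.Nullary.Decidable using (does; _×-dec_)

degree : ∀ {v} → List (Subset v) → Fin v → ℕ
degree blocks x = length (filter (λ B → x ∈? B) blocks)

codegree : ∀ {v} → List (Subset v) → Fin v → Fin v → ℕ
codegree blocks x y = length (filter (λ B → (x ∈? B) ×-dec (y ∈? B)) blocks)

-- Blocks form a list so that repetitions are allowed; the order of the list
-- plays no role.  The partition of the points into m groups is encoded by the
-- map sending each point to the index of its group.
record GDD (n m k λ₁ λ₂ : ℕ) : Set where
  field
    groupOf : Fin (m * n) → Fin m
    blocks  : List (Subset (m * n))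
    r       : ℕ

  group : Fin m → Subset (m * n)
  group g = tabulate (λ x → does (groupOf x ≟ g))

  field
    group-size : ∀ g → ∣ group g ∣ ≡ n
    block-size : All (λ B → ∣ B ∣ ≡ k) blocks
    regular    : ∀ x → degree blocks x ≡ r
    same-group : ∀ x y → x ≢ y → groupOf x ≡ groupOf y → codegree blocks x y ≡ λ₁
    diff-group : ∀ x y → groupOf x ≢ groupOf y → codegree blocks x y ≡ λ₂

HasConfiguration : ∀ {n k λ₁ λ₂} (s t : ℕ) → GDD n 2 k λ₁ λ₂ → Set
HasConfiguration s t D =
  All (λ B → Meets B zero (suc zero) ⊎ Meets B (suc zero) zero) blocks
  where
  open GDD D
  Meets : Subset _ → Fin 2 → Fin 2 → Set
  Meets B g h = (∣ B ∩ group g ∣ ≡ s) × (∣ B ∩ group h ∣ ≡ t)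

module Submission where

open import Data.Fin.Base using (Fin; zero; suc; toℕ; quotient)
open import Data.Fin.Properties using (_≟_; all?)
open import Data.Fin.Subset using (Subset; ∣_∣; _∩_)
open import Data.List.Base using (List; []; _∷_; concatMap; iterate)
open import Data.List.Membership.DecPropositional using (_∈?_)
import Data.List.Relation.Unary.All as All
open import Data.Nat.Base using (ℕ)
import Data.Nat.Properties as ℕ
open import Data.Product.Base using (Σ-syntax; _×_; _,_; map)
open import Data.Vec.Base using (tabulate; []; _∷_; _∷ʳ_; _++_)
open import Relation.Binary.PropositionalEquality using (_≡_)
open import Relation.Nullary.Decidable
  using (Dec; does; from-yes; ¬?; _→-dec_; _×-dec_; _⊎-dec_)
open import Defs

-- The group ℤ/15 acts on two copies of itself, and the swap of the copies commutes
-- with this action; the design is the union of the orbits of 15 base blocks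
-- P × {0} ∪ Q × {1} with ∣ P ∣ = 2 and ∣ Q ∣ = 4, each orbit having length 30.
-- The indices are 15 and 16 because each nonzero d ∈ ℤ/15 arises 15 times in total
-- as a difference within some P or within some Q, and each d ∈ ℤ/15 arises 16 times
-- in total as p − q or as q − p with p ∈ P and q ∈ Q.

residues : List ℕ → Subset 15
residues rs = tabulate (λ i → does (_∈?_ ℕ._≟_ (toℕ i) rs))

-- Found by simulated annealing on the difference counts.
baseBlocks : List (List ℕ × List ℕ)
baseBlocks =
    (0 ∷ 1 ∷ [] , 0 ∷ 2 ∷ 10 ∷ 13 ∷ [])
  ∷ (0 ∷ 1 ∷ [] , 1 ∷ 5 ∷ 6 ∷ 7 ∷ [])
  ∷ (0 ∷ 2 ∷ [] , 0 ∷ 5 ∷ 6 ∷ 11 ∷ [])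
  ∷ (0 ∷ 2 ∷ [] , 0 ∷ 6 ∷ 10 ∷ 11 ∷ [])
  ∷ (0 ∷ 2 ∷ [] , 1 ∷ 4 ∷ 10 ∷ 13 ∷ [])
  ∷ (0 ∷ 2 ∷ [] , 1 ∷ 5 ∷ 9 ∷ 12 ∷ [])
  ∷ (0 ∷ 3 ∷ [] , 3 ∷ 7 ∷ 8 ∷ 10 ∷ [])
  ∷ (0 ∷ 4 ∷ [] , 0 ∷ 2 ∷ 3 ∷ 6 ∷ [])
  ∷ (0 ∷ 4 ∷ [] , 0 ∷ 7 ∷ 8 ∷ 14 ∷ [])
  ∷ (0 ∷ 5 ∷ [] , 1 ∷ 2 ∷ 7 ∷ 8 ∷ [])
  ∷ (0 ∷ 5 ∷ [] , 3 ∷ 6 ∷ 8 ∷ 11 ∷ [])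
  ∷ (0 ∷ 6 ∷ [] , 5 ∷ 7 ∷ 9 ∷ 14 ∷ [])
  ∷ (0 ∷ 7 ∷ [] , 1 ∷ 3 ∷ 7 ∷ 13 ∷ [])
  ∷ (0 ∷ 7 ∷ [] , 5 ∷ 10 ∷ 12 ∷ 13 ∷ [])
  ∷ (0 ∷ 7 ∷ [] , 10 ∷ 11 ∷ 13 ∷ 14 ∷ [])
  ∷ []

-- For `n` = 15 this is translation by -1, a generator of ℤ/15: index `i` receives the entry at
-- `i + 1`.
rotate : ∀ {n} → Subset n → Subset n
rotate []      = []
rotate (b ∷ p) = p ∷ʳ b

orbit : List ℕ × List ℕ → List (Subset 30)
orbit (P , Q) =
  concatMap (λ (p , q) → (p ++ q) ∷ (q ++ p) ∷ [])
    (iterate (map rotate rotate) (residues P , residues Q) 15)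

blocks : List (Subset 30)
blocks = concatMap orbit baseBlocks

groupOf : Fin 30 → Fin 2
groupOf = quotient 15

-- Definitionally the `group` that `design` will have, so that its conditions can be decided
-- beforehand.
group : Fin 2 → Subset 30
group g = tabulate (λ x → does (groupOf x ≟ g))

design : GDD 15 2 6 15 16
design = record
  { groupOf    = groupOf
  ; blocks     = blocks
  -- Each of the 15 orbits has 30 blocks of size 6, and the symmetries are transitive on the 30
  -- points, so an orbit covers each point 6 times.
  ; r          = 90
  ; group-size = from-yes (all? λ g → ∣ group g ∣ ℕ.≟ 15)
  ; block-size = from-yes (All.all? (λ B → ∣ B ∣ ℕ.≟ 6) blocks)
  ; regular    = from-yes (all? λ x → degree blocks x ℕ.≟ 90)
  ; same-group = from-yes (all? λ x → all? λ y → ¬? (x ≟ y) →-dec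
                   (groupOf x ≟ groupOf y) →-dec (codegree blocks x y ℕ.≟ 15))
  ; diff-group = from-yes (all? λ x → all? λ y → ¬? (groupOf x ≟ groupOf y) →-dec
                   (codegree blocks x y ℕ.≟ 16))
  }

design-config : HasConfiguration 2 4 design
design-config = from-yes (All.all? (λ B → meets? B zero (suc zero) ⊎-dec
                                         meets? B (suc zero) zero) blocks)
  where
  meets? : ∀ B g h → Dec ((∣ B ∩ group g ∣ ≡ 2) × (∣ B ∩ group h ∣ ≡ 4))
  meets? B g h = (∣ B ∩ group g ∣ ℕ.≟ 2) ×-dec (∣ B ∩ group h ∣ ℕ.≟ 4)

theorem5p8 : Σ[ D ∈ GDD 15 2 6 15 16 ] HasConfiguration 2 4 D
theorem5p8 = design , design-config
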